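{- Let $G$ be a graph of girth $6$ such that $m^{\ast}(G)=3$. Then $\mathrm{b}^{\ast}(G)=4$.
   Context: All graphs are finite, nonempty, undirected, without loops or multiple edges. The girth of a graph is the length of its shortest cycle. A proper vertex coloring of $G$ with $k$ colors is a surjective map $c:V(G)\to\{1,\dots,k\}$ with $c(x)\neq c(y)$ for every edge $xy$. In such a coloring, a vertex $v$ is a b-vertex if for every color $j\neq c(v)$ among the $k$ colors, $v$ has a neighbor of color $j$. A vertex $u$ is nice if for every color $j\neq c(u)$, $u$ has a neighbor of color $j$ that is a b-vertex. A $\mathrm{b}^{\ast}$-coloring of $G$ is a proper coloring that has a nice vertex. $\mathrm{b}^{\ast}(G)$ is the maximum number of colors used in a $\mathrm{b}^{\ast}$-coloring of $G$. $m^{\ast}(G)$ is the largest integer $k\ge 0$ such that some vertex of degree at least $k$ in $G$ has at least $k$ neighbors each of degree at least $k$ in $G$. -}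

module Defs where

open import Level using (0ℓ)
open import Data.Nat.Base using (ℕ; suc; _≤_; NonZero)
open import Data.Nat.Properties using (_≤?_)
open import Data.Fin.Base using (Fin; zero; suc; inject₁; fromℕ)
open import Data.List.Base using (List; length; filter; allFin)
open import Data.Product.Base using (_×_; ∃-syntax)
open import Function.Definitions using (Injective; Surjective)
open import Relation.Binary.Core using (Rel)
open import Relation.Binary.Definitions using (Decidable; Irreflexive; Symmetric)
open import Relation.Binary.PropositionalEquality.Core using (_≡_; _≢_)
open import Relation.Unary using (Pred)

record Graph : Set₁ where
  infix 4 _~_ _~?_
  field
    order       : ℕ
    {{nonempty}} : NonZero order

  Vertex : Set
  Vertex = Fin order

  field
    _~_      : Rel Vertex 0ℓ
    _~?_     : Decidable _~_
    ~-irrefl : Irreflexive _≡_ _~_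
    ~-sym    : Symmetric _~_

IsLargest : Pred ℕ 0ℓ → Pred ℕ 0ℓ
IsLargest P k = P k × (∀ j → P j → j ≤ k)

IsLeast : Pred ℕ 0ℓ → Pred ℕ 0ℓ
IsLeast P k = P k × (∀ j → P j → k ≤ j)

module _ (G : Graph) where
  open Graph G

  neighbours : Vertex → List Vertex
  neighbours v = filter (v ~?_) (allFin order)

  degree : Vertex → ℕ
  degree v = length (neighbours v)

  -- The vertices x 0, …, x m form, in this cyclic order, a cycle of length suc m.
  record IsCycle {m : ℕ} (x : Fin (suc m) → Vertex) : Set where
    field
      length≥3  : 3 ≤ suc m
      injective : Injective _≡_ _≡_ x
      step      : ∀ (i : Fin m) → x (inject₁ i) ~ x (suc i)
      close     : x (fromℕ m) ~ x zero

  HasCycleOfLength : Pred ℕ 0ℓ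
  HasCycleOfLength k = ∃[ m ] k ≡ suc m × ∃[ x ] IsCycle {m} x

  -- Never satisfied by an acyclic graph.
  HasGirth : Pred ℕ 0ℓ
  HasGirth = IsLeast HasCycleOfLength

  IsProper : ∀ {k} → (Vertex → Fin k) → Set
  IsProper c = Surjective _≡_ _≡_ c × (∀ {x y} → x ~ y → c x ≢ c y)

  IsBVertex : ∀ {k} → (Vertex → Fin k) → Vertex → Set
  IsBVertex c v = ∀ j → j ≢ c v → ∃[ w ] v ~ w × c w ≡ j

  IsNice : ∀ {k} → (Vertex → Fin k) → Vertex → Set
  IsNice c u = ∀ j → j ≢ c u → ∃[ w ] u ~ w × c w ≡ j × IsBVertex c w

  IsB*Coloring : ∀ {k} → (Vertex → Fin k) → Set
  IsB*Coloring c = IsProper c × ∃[ u ] IsNice c u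

  HasB*Coloring : Pred ℕ 0ℓ
  HasB*Coloring k = ∃[ c ] IsB*Coloring {k} c

  -- IsB* k and IsM* k express b*(G) = k and m*(G) = k.
  IsB* : Pred ℕ 0ℓ
  IsB* = IsLargest HasB*Coloring

  HasDenseVertex : Pred ℕ 0ℓ
  HasDenseVertex k = ∃[ v ] k ≤ degree v ×
    k ≤ length (filter (λ w → k ≤? degree w) (neighbours v))

  IsM* : Pred ℕ 0ℓ
  IsM* = IsLargest HasDenseVertex

{-# OPTIONS --safe #-}
-- A nice vertex of a colouring with k + 1 colours has k neighbours that are b-vertices of distinct
-- colours, hence of degree at least k, so b*(G) ≤ m*(G) + 1.
--
-- Conversely let u have neighbours a₀, a₁, a₂ of degree at least 3, and pick two further neighbours
-- of each aᵢ, its "feet". Colour u with 0, aᵢ with i + 1 and the two feet of aᵢ with the two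
-- remaining nonzero colours: this makes u nice. Call a vertex thick if it has degree at least 4 or
-- is some aᵢ. A thick vertex adjacent to feet of only one aᵢ gets colour i + 1 (consistently with
-- the colour of aᵢ itself), and one adjacent to feet of several aᵢ gets colour 0. There are no closed
-- walks of length 3 or 5, so vertices adjacent to feet of the same aᵢ are not adjacent to each other;
-- and as any two pairs of indices from {0, 1, 2} meet, the partial colouring is proper.
--
-- An uncoloured vertex x of degree at least 4 is adjacent to no foot, and if it is adjacent to u or
-- to some aᵢ then x is a fourth neighbour of that vertex. So all its coloured neighbours have degree
-- at least 4, and since m*(G) < 4 there are at most three of these. Hence the colouring extends
-- greedily to all vertices of degree at least 4, and then to those of degree at most 3.
module Submission where

open import Defs
open import Data.Empty using (⊥; ⊥-elim)
open import Data.Fin.Base using (Fin; zero; suc; punchIn; punchOut; inject≤)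
open import Data.Fin.Properties using (_≟_; any?; all?; ¬∀⟶∃¬; injective⇒≤; inject≤-injective; punchIn-injective; punchInᵢ≢i; punchIn-punchOut; suc-injective; 0≢1+n)
open import Data.List.Base using (List; []; _∷_; length; filter; lookup; map; allFin)
open import Data.List.Membership.Propositional using (_∈_; _∉_)
open import Data.List.Membership.Propositional.Properties using (∈-lookup; ∈-filter⁺; ∈-filter⁻; ∈-allFin; ∈-map⁺)
open import Data.List.Membership.DecPropositional using (_∈?_)
open import Data.List.Properties using (length-filter; length-map)
open import Data.List.Relation.Unary.All as All using ([]; _∷_)
open import Data.List.Relation.Unary.AllPairs using ([]; _∷_)
open import Data.List.Relation.Unary.Any using (here; there)
open import Data.List.Relation.Unary.Any.Properties using (lookup-index)
open import Data.List.Relation.Unary.Unique.Propositional using (Unique)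
open import Data.List.Relation.Unary.Unique.Propositional.Properties using (allFin⁺; filter⁺)
open import Data.Nat.Base using (zero; suc; _≤_; _<_; z≤n; s≤s)
open import Data.Nat.Properties using (_≤?_; ≤-refl; ≤-trans; ≤-reflexive; <⇒≱; ≰⇒>; ≤-<-trans)
open import Data.Product.Base using (∃; ∃-syntax; _×_; _,_; proj₁; proj₂)
open import Data.Sum.Base using (_⊎_; inj₁; inj₂; [_,_]′)
open import Data.Unit.Base using (⊤; tt)
import Data.Vec.Functional as Vector
open import Data.Vec.Functional.Properties using (updateAt-updates; updateAt-minimal)
open import Function.Base using (_∘_; const; id)
open import Function.Definitions using (Injective)
open import Level using (0ℓ)
open import Relation.Binary.PropositionalEquality using (_≡_; _≢_; refl; sym; trans; cong; subst; ≢-sym)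
open import Relation.Nullary.Decidable using (yes; no; ¬?; _⊎-dec_; _×-dec_; _→-dec_; decidable-stable; from-yes)
open import Relation.Nullary.Negation using (¬_; contradiction)
open import Relation.Unary using (Pred; Decidable)

-- Counting with injections into lists and finite sets.

module _ {A : Set} where

  lookup-injective : ∀ {xs : List A} → Unique xs → Injective _≡_ _≡_ (lookup xs)
  lookup-injective {_ ∷ _}  _        {zero}  {zero}  _  = refl
  lookup-injective {_ ∷ xs} (p ∷ _)  {zero}  {suc j} eq = contradiction eq (All.lookup p (∈-lookup {xs = xs} j))
  lookup-injective {_ ∷ xs} (p ∷ _)  {suc i} {zero}  eq = contradiction (sym eq) (All.lookup p (∈-lookup {xs = xs} i))
  lookup-injective {_ ∷ _}  (_ ∷ ps) {suc i} {suc j} eq = cong suc (lookup-injective ps eq)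

  injective⇒≤length : ∀ {n} {f : Fin n → A} {xs} →
    Injective _≡_ _≡_ f → (∀ i → f i ∈ xs) → n ≤ length xs
  injective⇒≤length {f = f} {xs} inj f∈xs = injective⇒≤ λ {i} {j} eq →
    inj (trans (lookup-index (f∈xs i)) (trans (cong (lookup xs) eq) (sym (lookup-index (f∈xs j)))))

  Unique-⊆⇒length≤ : ∀ {xs ys : List A} → Unique xs → (∀ {x} → x ∈ xs → x ∈ ys) →
    length xs ≤ length ys
  Unique-⊆⇒length≤ {xs} u xs⊆ys = injective⇒≤length (lookup-injective u) (xs⊆ys ∘ ∈-lookup {xs = xs})

  distinctElements : ∀ {n} {xs : List A} → Unique xs → n ≤ length xs →
    ∃[ f ] Injective {A = Fin n} _≡_ _≡_ f × (∀ i → f i ∈ xs)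
  distinctElements {xs = xs} u n≤ =
      (λ i → lookup xs (inject≤ i n≤))
    , (λ {i} {j} → inject≤-injective n≤ n≤ i j ∘ lookup-injective u)
    , (λ i → ∈-lookup {xs = xs} (inject≤ i n≤))

  ∷-injective : ∀ {n x} {f : Fin n → A} → (∀ i → x ≢ f i) → Injective _≡_ _≡_ f →
    Injective _≡_ _≡_ (x Vector.∷ f)
  ∷-injective x≢ inj {zero}  {zero}  _  = refl
  ∷-injective x≢ inj {zero}  {suc j} eq = contradiction eq (x≢ j)
  ∷-injective x≢ inj {suc i} {zero}  eq = contradiction (sym eq) (x≢ i)
  ∷-injective x≢ inj {suc i} {suc j} eq = cong suc (inj eq)

-- By injectivity at most one index hits `x`; that index is discarded, or an arbitrary one if `x` is
-- missed. This is how the body is removed from three neighbours of a knee.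
injective⇒∃avoiding : ∀ {m n} {f : Fin (suc n) → Fin m} → Injective _≡_ _≡_ f → ∀ x →
  ∃[ i ] ∀ k → f (punchIn i k) ≢ x
injective⇒∃avoiding {f = f} inj x with any? (λ i → f i ≟ x)
... | yes (i , fi≡x) = i , λ k eq → punchInᵢ≢i i k (inj (trans eq (sym fi≡x)))
... | no  f≢x        = zero , λ k eq → f≢x (_ , eq)

length<⇒∃∉ : ∀ {n} (xs : List (Fin n)) → length xs < n → ∃[ y ] y ∉ xs
length<⇒∃∉ xs short = ¬∀⟶∃¬ _ (_∈ xs) (λ y → _∈?_ _≟_ y xs)
  λ full → <⇒≱ short (injective⇒≤length id full)

-- Two pairs in a set of three elements meet because 2 + 2 > 3; checked by exhaustion.
pairsMeet : ∀ (i i′ j j′ : Fin 3) → i ≢ i′ → j ≢ j′ →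
  (i ≡ j ⊎ i ≡ j′) ⊎ (i′ ≡ j ⊎ i′ ≡ j′)
pairsMeet = from-yes (all? {n = 3} λ i → all? {n = 3} λ i′ → all? {n = 3} λ j → all? {n = 3} λ j′ →
  ¬? (i ≟ i′) →-dec (¬? (j ≟ j′) →-dec
    (((i ≟ j) ⊎-dec (i ≟ j′)) ⊎-dec ((i′ ≟ j) ⊎-dec (i′ ≟ j′)))))

-- Neighbourhoods and degrees.

module _ (G : Graph) where
  open Graph G

  ~⇒≢ : ∀ {x y} → x ~ y → x ≢ y
  ~⇒≢ x~y x≡y = ~-irrefl x≡y x~y

  ∈-neighbours⁺ : ∀ {v w} → v ~ w → w ∈ neighbours G v
  ∈-neighbours⁺ {v} {w} = ∈-filter⁺ (v ~?_) (∈-allFin w)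

  ∈-neighbours⁻ : ∀ {v w} → w ∈ neighbours G v → v ~ w
  ∈-neighbours⁻ {v} = proj₂ ∘ ∈-filter⁻ (v ~?_) {xs = allFin order}

  neighbours-unique : ∀ v → Unique (neighbours G v)
  neighbours-unique v = filter⁺ (v ~?_) (allFin⁺ order)

  injective⇒≤degree : ∀ {n v} {f : Fin n → Vertex} → Injective _≡_ _≡_ f →
    (∀ i → v ~ f i) → n ≤ degree G v
  injective⇒≤degree inj v~f = injective⇒≤length inj (∈-neighbours⁺ ∘ v~f)

  -- Greedy extension of partial proper colourings.

  ProperOn : ∀ {n} → Pred Vertex 0ℓ → (Vertex → Fin n) → Set
  ProperOn S c = ∀ {x y} → S x → S y → x ~ y → c x ≢ c y

  module _ {n} {S U : Pred Vertex 0ℓ} (S? : Decidable S) (U? : Decidable U)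
    (S⊆U : ∀ {x} → S x → U x)
    (few : ∀ {x} → U x → ¬ S x → length (filter U? (neighbours G x)) < n)
    (c₀ : Vertex → Fin n) (c₀-proper : ProperOn S c₀)
    where

    private
      -- Induction on the list of vertices to be coloured: those in `S` keep their colour, any other
      -- is recoloured with a colour that `few` leaves free.
      extendAlong : (vs : List Vertex) → (∀ {x} → x ∈ vs → U x) →
        ∃[ c ] ProperOn (λ x → S x ⊎ x ∈ vs) c × (∀ {x} → S x → c x ≡ c₀ x)
      extendAlong [] _ = c₀ , (λ { (inj₁ sx) (inj₁ sy) → c₀-proper sx sy }) , λ _ → refl
      extendAlong (v ∷ vs) vs⊆U with extendAlong vs (vs⊆U ∘ there)
      ... | c , proper , agrees with S? v
      ...   | yes sv = c , (λ x∈ y∈ → proper (drop x∈) (drop y∈)) , agrees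
        where
        drop : ∀ {x} → S x ⊎ x ∈ v ∷ vs → S x ⊎ x ∈ vs
        drop (inj₁ sx)           = inj₁ sx
        drop (inj₂ (here refl))  = inj₁ sv
        drop (inj₂ (there x∈vs)) = inj₂ x∈vs
      ...   | no ¬sv = c′ , proper′ , λ sx → trans (minimal (λ { refl → ¬sv sx })) (agrees sx)
        where
        -- All neighbours in `U` count, even those not yet treated, whose current colour is
        -- arbitrary; so `few` bounds the length whatever the order of treatment.
        forbidden : List (Fin n)
        forbidden = map c (filter U? (neighbours G v))

        free : ∃[ k ] k ∉ forbidden
        free = length<⇒∃∉ forbidden
          (≤-<-trans (≤-reflexive (length-map c (filter U? (neighbours G v)))) (few (vs⊆U (here refl)) ¬sv))

        c′ : Vertex → Fin n
        c′ = Vector.updateAt c v (const (proj₁ free))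

        updates : c′ v ≡ proj₁ free
        updates = updateAt-updates v c

        minimal : ∀ {x} → x ≢ v → c′ x ≡ c x
        minimal {x} = updateAt-minimal x v c

        S∪vs⊆U : ∀ {x} → S x ⊎ x ∈ v ∷ vs → U x
        S∪vs⊆U = [ S⊆U , vs⊆U ]′

        drop : ∀ {x} → x ≢ v → S x ⊎ x ∈ v ∷ vs → S x ⊎ x ∈ vs
        drop x≢v (inj₁ sx)           = inj₁ sx
        drop x≢v (inj₂ (here x≡v))   = contradiction x≡v x≢v
        drop x≢v (inj₂ (there x∈vs)) = inj₂ x∈vs

        v≢neighbour : ∀ {y} → U y → v ~ y → c′ v ≢ c′ y
        v≢neighbour uy v~y eq = proj₂ free (subst (_∈ forbidden)
          (trans (sym (minimal (≢-sym (~⇒≢ v~y)))) (trans (sym eq) updates))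
          (∈-map⁺ c (∈-filter⁺ U? (∈-neighbours⁺ v~y) uy)))

        proper′ : ProperOn (λ x → S x ⊎ x ∈ v ∷ vs) c′
        proper′ {x} {y} x∈ y∈ x~y with x ≟ v | y ≟ v
        ... | yes refl | _        = v≢neighbour (S∪vs⊆U y∈) x~y
        ... | no _     | yes refl = v≢neighbour (S∪vs⊆U x∈) (~-sym x~y) ∘ sym
        ... | no x≢v   | no y≢v   = λ eq → proper (drop x≢v x∈) (drop y≢v y∈) x~y
          (trans (sym (minimal x≢v)) (trans eq (minimal y≢v)))

    greedyExtension : ∃[ c ] ProperOn U c × (∀ {x} → S x → c x ≡ c₀ x)
    greedyExtension with extendAlong (filter U? (allFin order)) (proj₂ ∘ ∈-filter⁻ U? {xs = allFin order})
    ... | c , proper , agrees = c , (λ ux uy → proper (listed ux) (listed uy)) , agrees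
      where
      listed : ∀ {x} → U x → S x ⊎ x ∈ filter U? (allFin order)
      listed {x} ux = inj₂ (∈-filter⁺ U? (∈-allFin x) ux)

  -- The upper bound.

  b*-coloring⇒dense : ∀ {k} → HasB*Coloring G (suc k) → HasDenseVertex G k
  b*-coloring⇒dense {k} (c , _ , u , nice) =
      u
    , injective⇒≤degree w-injective u~w
    , injective⇒≤length w-injective (λ i → ∈-filter⁺ _ (∈-neighbours⁺ (u~w i)) (w-degree i))
    where
    -- `punchIn (c u)` enumerates the `k` colours other than that of `u`; distinct colours make the
    -- chosen neighbours distinct.
    b-neighbour : ∀ i → ∃[ w ] u ~ w × c w ≡ punchIn (c u) i × IsBVertex G c w
    b-neighbour i = nice (punchIn (c u) i) (punchInᵢ≢i (c u) i)

    w : Fin k → Vertex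
    w i = proj₁ (b-neighbour i)

    u~w : ∀ i → u ~ w i
    u~w i = proj₁ (proj₂ (b-neighbour i))

    w-injective : Injective _≡_ _≡_ w
    w-injective {i} {j} eq = punchIn-injective (c u) i j
      (trans (sym (proj₁ (proj₂ (proj₂ (b-neighbour i)))))
        (trans (cong c eq) (proj₁ (proj₂ (proj₂ (b-neighbour j))))))

    b-vertex-degree : ∀ {v} → IsBVertex G c v → k ≤ degree G v
    b-vertex-degree {v} b = injective⇒≤degree {f = λ i → proj₁ (at i)}
      (λ {i} {j} eq → punchIn-injective (c v) i j
        (trans (sym (proj₂ (proj₂ (at i)))) (trans (cong c eq) (proj₂ (proj₂ (at j))))))
      (λ i → proj₁ (proj₂ (at i)))
      where
      at : ∀ i → ∃[ x ] v ~ x × c x ≡ punchIn (c v) i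
      at i = b (punchIn (c v) i) (punchInᵢ≢i (c v) i)

    w-degree : ∀ i → k ≤ degree G (w i)
    w-degree i = b-vertex-degree (proj₂ (proj₂ (proj₂ (b-neighbour i))))

  -- The configuration around a dense vertex.

  -- The body is the vertex u and the knees are the aᵢ of the outline. That different knees have
  -- different feet is derived from the girth in `foot-index`.
  record Spider : Set where
    field
      body           : Vertex
      knee           : Fin 3 → Vertex
      foot           : Fin 3 → Fin 2 → Vertex
      knee-injective : Injective _≡_ _≡_ knee
      foot-injective : ∀ i → Injective _≡_ _≡_ (foot i)
      body~knee      : ∀ i → body ~ knee i
      knee~foot      : ∀ i k → knee i ~ foot i k
      foot≢body      : ∀ i k → foot i k ≢ body

  dense⇒spider : HasDenseVertex G 3 → Spider
  dense⇒spider (u , _ , dense) with distinctElements (filter⁺ _ (neighbours-unique u)) dense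
  ... | knee , knee-inj , knee∈ = record
    { body           = u
    ; knee           = knee
    ; foot           = λ i k → around i (punchIn (pivot i) k)
    ; knee-injective = knee-inj
    ; foot-injective = λ i {k} {l} → punchIn-injective (pivot i) k l ∘ proj₁ (proj₂ (star i))
    ; body~knee      = λ i → ∈-neighbours⁻ (proj₁ (knee∈⁻ i))
    ; knee~foot      = λ i k → ∈-neighbours⁻ (proj₂ (proj₂ (star i)) (punchIn (pivot i) k))
    ; foot≢body      = λ i → proj₂ (avoid i)
    }
    where
    knee∈⁻ : ∀ i → knee i ∈ neighbours G u × 3 ≤ degree G (knee i)
    knee∈⁻ i = ∈-filter⁻ (λ w → 3 ≤? degree G w) {xs = neighbours G u} (knee∈ i)

    star : ∀ i → ∃[ f ] Injective {A = Fin 3} _≡_ _≡_ f × (∀ k → f k ∈ neighbours G (knee i))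
    star i = distinctElements (neighbours-unique (knee i)) (proj₂ (knee∈⁻ i))

    around : Fin 3 → Fin 3 → Vertex
    around i = proj₁ (star i)

    avoid : ∀ i → ∃[ p ] ∀ k → around i (punchIn p k) ≢ u
    avoid i = injective⇒∃avoiding (proj₁ (proj₂ (star i))) u

    pivot : Fin 3 → Fin 3
    pivot i = proj₁ (avoid i)

  -- Short closed walks.

  module _ (girth≥6 : ∀ k → HasCycleOfLength G k → 6 ≤ k) where

    no-triangle : ∀ {x y z} → x ~ y → y ~ z → z ~ x → ⊥
    no-triangle {x} {y} {z} xy yz zx
      with s≤s (s≤s (s≤s ())) ← girth≥6 3 (2 , refl , lookup (x ∷ y ∷ z ∷ []) , record
        { length≥3  = ≤-refl
        ; injective = lookup-injective
            ((~⇒≢ xy ∷ ≢-sym (~⇒≢ zx) ∷ []) ∷ (~⇒≢ yz ∷ []) ∷ [] ∷ [])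
        ; step      = λ { zero → xy ; (suc zero) → yz }
        ; close     = zx
        })

    -- If both pairs of opposite vertices were distinct, the walk would be a 4-cycle.
    closed4-degenerate : ∀ {x y z w} → x ~ y → y ~ z → z ~ w → w ~ x → x ≡ z ⊎ y ≡ w
    closed4-degenerate {x} {y} {z} {w} xy yz zw wx with x ≟ z | y ≟ w
    ... | yes x≡z | _       = inj₁ x≡z
    ... | no _    | yes y≡w = inj₂ y≡w
    ... | no x≢z  | no y≢w
      with s≤s (s≤s (s≤s (s≤s ()))) ← girth≥6 4 (3 , refl , lookup (x ∷ y ∷ z ∷ w ∷ []) , record
        { length≥3  = s≤s (s≤s (s≤s z≤n))
        ; injective = lookup-injective
            ( (~⇒≢ xy ∷ x≢z ∷ ≢-sym (~⇒≢ wx) ∷ [])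
            ∷ (~⇒≢ yz ∷ y≢w ∷ []) ∷ (~⇒≢ zw ∷ []) ∷ [] ∷ [])
        ; step      = λ { zero → xy ; (suc zero) → yz ; (suc (suc zero)) → zw }
        ; close     = wx
        })

    -- Two equal nonconsecutive vertices would split off a triangle.
    no-closed5 : ∀ {x y z w v} → x ~ y → y ~ z → z ~ w → w ~ v → v ~ x → ⊥
    no-closed5 {x} {y} {z} {w} {v} xy yz zw wv vx
      with s≤s (s≤s (s≤s (s≤s (s≤s ())))) ← girth≥6 5 (4 , refl , lookup (x ∷ y ∷ z ∷ w ∷ v ∷ []) , record
        { length≥3  = s≤s (s≤s (s≤s z≤n))
        ; injective = lookup-injective
            ( (~⇒≢ xy ∷ (λ { refl → no-triangle zw wv vx }) ∷ (λ { refl → no-triangle xy yz zw })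
                ∷ ≢-sym (~⇒≢ vx) ∷ [])
            ∷ (~⇒≢ yz ∷ (λ { refl → no-triangle wv vx xy }) ∷ (λ { refl → no-triangle yz zw wv }) ∷ [])
            ∷ (~⇒≢ zw ∷ (λ { refl → no-triangle vx xy yz }) ∷ [])
            ∷ (~⇒≢ wv ∷ []) ∷ [] ∷ [])
        ; step      = λ { zero → xy ; (suc zero) → yz ; (suc (suc zero)) → zw ; (suc (suc (suc zero))) → wv }
        ; close     = vx
        })

    -- The partial colouring of a spider and its surroundings.

    module _ (spider : Spider) where
      open Spider spider

      High : Pred Vertex 0ℓ
      High x = 4 ≤ degree G x

      Thick : Pred Vertex 0ℓ
      Thick x = High x ⊎ ∃[ i ] x ≡ knee i

      Near : Fin 3 → Pred Vertex 0ℓ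
      Near i x = ∃[ k ] x ~ foot i k

      -- A relation rather than a function, so that the rules may overlap; `colour-unique` shows
      -- that they agree. Knees need no rule of their own: each is thick and near its own feet only,
      -- so `nearOne` applies.
      data Colour : Vertex → Fin 4 → Set where
        atBody   : Colour body zero
        -- `punchIn i` runs through the two indices other than `i`.
        atFoot   : ∀ i k → Colour (foot i k) (suc (punchIn i k))
        nearMany : ∀ {x i i′} → Thick x → i ≢ i′ → Near i x → Near i′ x → Colour x zero
        nearOne  : ∀ {x i} → Thick x → Near i x → (∀ {i′} → Near i′ x → i′ ≡ i) → Colour x (suc i)

      Coloured : Pred Vertex 0ℓ
      Coloured x = ∃ (Colour x)

      body-notNear : ∀ {i} → ¬ Near i body
      body-notNear {i} (k , e) = no-triangle e (~-sym (knee~foot i k)) (~-sym (body~knee i))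

      -- Any two feet are joined by a walk of length 4 through the body, which backtracks if their
      -- knee is the same; an edge would close it to length 5.
      foot-notNear : ∀ {i j k} → ¬ Near i (foot j k)
      foot-notNear {i} {j} {k} (l , e) = no-closed5
        (~-sym (knee~foot j k)) (~-sym (body~knee j)) (body~knee i) (knee~foot i l) (~-sym e)

      -- An edge would close the walk from `x` over a foot, knee `i` and a foot to `y`, again giving
      -- length 5.
      near≁near : ∀ {i x y} → Near i x → Near i y → ¬ x ~ y
      near≁near {i} (k , e) (l , e′) x~y =
        no-closed5 e (~-sym (knee~foot i k)) (knee~foot i l) (~-sym e′) (~-sym x~y)

      -- The closed walk body, `x`, foot, knee must degenerate, and the foot is not the body.
      near∧body⇒knee : ∀ {i x} → Near i x → body ~ x → x ≡ knee i
      near∧body⇒knee {i} (k , e) body~x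
        with closed4-degenerate body~x e (~-sym (knee~foot i k)) (~-sym (body~knee i))
      ... | inj₁ body≡foot = contradiction (sym body≡foot) (foot≢body i k)
      ... | inj₂ x≡knee    = x≡knee

      knee-near : ∀ i → Near i (knee i)
      knee-near i = zero , knee~foot i zero

      near-knee⇒≡ : ∀ {i j} → Near i (knee j) → i ≡ j
      near-knee⇒≡ {i} {j} near = knee-injective (sym (near∧body⇒knee near (body~knee j)))

      foot-index : ∀ {i j k l} → foot i k ≡ foot j l → i ≡ j
      foot-index {i} {j} {k} {l} eq
        with closed4-degenerate (body~knee i) (knee~foot i k)
               (subst (_~ knee j) (sym eq) (~-sym (knee~foot j l))) (~-sym (body~knee j))
      ... | inj₁ body≡foot = contradiction (sym body≡foot) (foot≢body i k)
      ... | inj₂ knee≡knee = knee-injective knee≡knee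

      manyNear≁manyNear : ∀ {i i′ j j′ x y} → i ≢ i′ → j ≢ j′ →
        Near i x → Near i′ x → Near j y → Near j′ y → ¬ x ~ y
      manyNear≁manyNear i≢i′ j≢j′ p p′ q q′ with pairsMeet _ _ _ _ i≢i′ j≢j′
      ... | inj₁ (inj₁ refl) = near≁near p q
      ... | inj₁ (inj₂ refl) = near≁near p q′
      ... | inj₂ (inj₁ refl) = near≁near p′ q
      ... | inj₂ (inj₂ refl) = near≁near p′ q′

      -- Two vertices with an equation, instead of one vertex, let both derivations be matched
      -- without unifying terms such as `foot i k` and `foot j l`.
      colour-unique : ∀ {x y c d} → Colour x c → Colour y d → x ≡ y → c ≡ d
      colour-unique atBody                 atBody                 _    = refl
      colour-unique atBody                 (atFoot j l)           eq   = contradiction (sym eq) (foot≢body j l)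
      colour-unique atBody                 (nearMany _ _ q _)     refl = ⊥-elim (body-notNear q)
      colour-unique atBody                 (nearOne _ q _)        refl = ⊥-elim (body-notNear q)
      colour-unique (atFoot i k)           atBody                 eq   = contradiction eq (foot≢body i k)
      colour-unique (atFoot i k)           (atFoot j l)           eq with refl ← foot-index eq
                                                                       = cong (suc ∘ punchIn i) (foot-injective i eq)
      colour-unique (atFoot i k)           (nearMany _ _ q _)     refl = ⊥-elim (foot-notNear q)
      colour-unique (atFoot i k)           (nearOne _ q _)        refl = ⊥-elim (foot-notNear q)
      colour-unique (nearMany _ _ p _)     atBody                 refl = ⊥-elim (body-notNear p)
      colour-unique (nearMany _ _ p _)     (atFoot j l)           refl = ⊥-elim (foot-notNear p)
      colour-unique (nearMany _ _ _ _)     (nearMany _ _ _ _)     _    = refl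
      colour-unique (nearMany _ i≢i′ p p′) (nearOne _ _ only)     refl = contradiction (trans (only p) (sym (only p′))) i≢i′
      colour-unique (nearOne _ p _)        atBody                 refl = ⊥-elim (body-notNear p)
      colour-unique (nearOne _ p _)        (atFoot j l)           refl = ⊥-elim (foot-notNear p)
      colour-unique (nearOne _ _ only)     (nearMany _ j≢j′ q q′) refl = contradiction (trans (only q) (sym (only q′))) j≢j′
      colour-unique (nearOne _ _ only)     (nearOne _ q _)        refl = cong suc (sym (only q))

      body≁manyNear : ∀ {i i′ x} → i ≢ i′ → Near i x → Near i′ x → ¬ body ~ x
      body≁manyNear i≢i′ p p′ body~x =
        i≢i′ (knee-injective (trans (sym (near∧body⇒knee p body~x)) (near∧body⇒knee p′ body~x)))

      -- The hypothesis forces `i` to be `j`, and a foot never takes the colour of its own knee.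
      foot-nearOne : ∀ {i j k x} → (∀ {i′} → Near i′ x → i′ ≡ j) → x ~ foot i k → punchIn i k ≢ j
      foot-nearOne {i} {j} {k} only x~foot eq = punchInᵢ≢i i k (trans eq (sym (only (k , x~foot))))

      -- Zero and nonzero colours differ at once. The other cases exclude the edge by a short closed
      -- walk, except for a foot next to a `nearOne` vertex, where the colours differ.
      colour-proper : ∀ {x y c d} → Colour x c → Colour y d → x ~ y → c ≢ d
      colour-proper atBody                 atBody                 e = contradiction refl (~⇒≢ e)
      colour-proper atBody                 (atFoot _ _)           _ = 0≢1+n
      colour-proper atBody                 (nearMany _ i≢i′ q q′) e = contradiction e (body≁manyNear i≢i′ q q′)
      colour-proper atBody                 (nearOne _ _ _)        _ = 0≢1+n
      colour-proper (atFoot _ _)           atBody                 _ = ≢-sym 0≢1+n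
      colour-proper (atFoot _ _)           (atFoot _ l)           e = ⊥-elim (foot-notNear (l , e))
      colour-proper (atFoot _ _)           (nearMany _ _ _ _)     _ = ≢-sym 0≢1+n
      colour-proper (atFoot _ _)           (nearOne _ _ only)     e = foot-nearOne only (~-sym e) ∘ suc-injective
      colour-proper (nearMany _ i≢i′ p p′) atBody                 e = contradiction (~-sym e) (body≁manyNear i≢i′ p p′)
      colour-proper (nearMany _ _ _ _)     (atFoot _ _)           _ = 0≢1+n
      colour-proper (nearMany _ i≢i′ p p′) (nearMany _ j≢j′ q q′) e = contradiction e (manyNear≁manyNear i≢i′ j≢j′ p p′ q q′)
      colour-proper (nearMany _ _ _ _)     (nearOne _ _ _)        _ = 0≢1+n
      colour-proper (nearOne _ _ _)        atBody                 _ = ≢-sym 0≢1+n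
      colour-proper (nearOne _ _ only)     (atFoot _ _)           e = ≢-sym (foot-nearOne only e) ∘ suc-injective
      colour-proper (nearOne _ _ _)        (nearMany _ _ _ _)     _ = ≢-sym 0≢1+n
      colour-proper (nearOne _ p _)        (nearOne _ q _)        e = λ { refl → near≁near p q e }

      -- Deciding which vertices are coloured.

      High? : Decidable High
      High? x = 4 ≤? degree G x

      Thick? : Decidable Thick
      Thick? x = High? x ⊎-dec any? (λ i → x ≟ knee i)

      Near? : ∀ i → Decidable (Near i)
      Near? i x = any? λ k → x ~? foot i k

      thick∧near⇒coloured : ∀ {i x} → Thick x → Near i x → Coloured x
      thick∧near⇒coloured {i} {x} thick near with any? (λ i′ → ¬? (i ≟ i′) ×-dec Near? i′ x)
      ... | yes (_ , i≢i′ , near′) = _ , nearMany thick i≢i′ near near′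
      ... | no  none               = _ , nearOne thick near λ {i′} near′ →
        sym (decidable-stable (i ≟ i′) λ i≢i′ → none (i′ , i≢i′ , near′))

      Coloured? : Decidable Coloured
      Coloured? x with x ≟ body | any? (λ i → any? λ k → x ≟ foot i k) | Thick? x | any? (λ i → Near? i x)
      ... | yes refl  | _                  | _         | _              = yes (_ , atBody)
      ... | no _      | yes (i , k , refl) | _         | _              = yes (_ , atFoot i k)
      ... | no _      | no _               | yes thick | yes (_ , near) = yes (thick∧near⇒coloured thick near)
      ... | no x≢body | no x≢foot          | no ¬thick | _              = no λ where
        (_ , atBody)               → x≢body refl
        (_ , atFoot i k)           → x≢foot (i , k , refl)
        (_ , nearMany thick _ _ _) → ¬thick thick
        (_ , nearOne thick _ _)    → ¬thick thick
      ... | no x≢body | no x≢foot          | yes _     | no ¬near       = no λ where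
        (_ , atBody)              → x≢body refl
        (_ , atFoot i k)          → x≢foot (i , k , refl)
        (_ , nearMany _ _ near _) → ¬near (_ , near)
        (_ , nearOne _ near _)    → ¬near (_ , near)

      knee-colour : ∀ i → Colour (knee i) (suc i)
      knee-colour i = nearOne (inj₂ (i , refl)) (knee-near i) near-knee⇒≡

      spiderColouring : Vertex → Fin 4
      spiderColouring x with Coloured? x
      ... | yes (c , _) = c
      -- A placeholder: only values at coloured vertices are ever relied on.
      ... | no _        = zero

      spiderColouring-colour : ∀ {x} → Coloured x → Colour x (spiderColouring x)
      spiderColouring-colour {x} coloured with Coloured? x
      ... | yes (_ , colour) = colour
      ... | no ¬coloured     = contradiction coloured ¬coloured

      -- Neighbours of uncoloured vertices.

      -- All knees are coloured, so `x` is a fourth neighbour of the body.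
      body-high : ∀ {x} → ¬ Coloured x → body ~ x → High body
      body-high ¬coloured e = injective⇒≤degree
        (∷-injective (λ { i refl → ¬coloured (_ , knee-colour i) }) knee-injective)
        (λ { zero → e ; (suc i) → body~knee i })

      -- The body and the feet are coloured, so `x` is a neighbour besides these three.
      knee-high : ∀ {x i} → ¬ Coloured x → knee i ~ x → High (knee i)
      knee-high {i = i} ¬coloured e = injective⇒≤degree
        (∷-injective
          (λ { zero refl → ¬coloured (_ , atBody) ; (suc k) refl → ¬coloured (_ , atFoot i k) })
          (∷-injective (λ k → ≢-sym (foot≢body i k)) (foot-injective i)))
        (λ { zero → e ; (suc zero) → ~-sym (body~knee i) ; (suc (suc k)) → knee~foot i k })

      thick-high : ∀ {x y} → ¬ Coloured x → x ~ y → Thick y → High y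
      thick-high _         _ (inj₁ high)       = high
      thick-high ¬coloured e (inj₂ (i , refl)) = knee-high ¬coloured (~-sym e)

      coloured-neighbour-high : ∀ {x y} → High x → ¬ Coloured x → x ~ y → Coloured y → High y
      coloured-neighbour-high _    ¬x e (_ , atBody)               = body-high ¬x (~-sym e)
      coloured-neighbour-high high ¬x e (_ , atFoot i k)           =
        contradiction (thick∧near⇒coloured (inj₁ high) (k , e)) ¬x
      coloured-neighbour-high _    ¬x e (_ , nearMany thick _ _ _) = thick-high ¬x e thick
      coloured-neighbour-high _    ¬x e (_ , nearOne thick _ _)    = thick-high ¬x e thick

      -- Extension to the whole graph.

      module _ (¬dense : ¬ HasDenseVertex G 4) where

        fewHighNeighbours : ∀ x → length (filter High? (neighbours G x)) < 4
        fewHighNeighbours x = ≰⇒> λ dense →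
          -- Four high neighbours already give `x` itself degree at least 4.
          ¬dense (x , ≤-trans dense (length-filter High? (neighbours G x)) , dense)

        Coloured∪High? : Decidable (λ x → Coloured x ⊎ High x)
        Coloured∪High? x = Coloured? x ⊎-dec High? x

        fewColoured∪High : ∀ {x} → Coloured x ⊎ High x → ¬ Coloured x →
          length (filter Coloured∪High? (neighbours G x)) < 4
        fewColoured∪High     (inj₁ coloured) ¬coloured = contradiction coloured ¬coloured
        fewColoured∪High {x} (inj₂ high)     ¬coloured = ≤-<-trans
          (Unique-⊆⇒length≤ (filter⁺ Coloured∪High? (neighbours-unique x)) keep) (fewHighNeighbours x)
          where
          keep : ∀ {y} → y ∈ filter Coloured∪High? (neighbours G x) → y ∈ filter High? (neighbours G x)
          keep y∈ with ∈-filter⁻ Coloured∪High? {xs = neighbours G x} y∈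
          ... | y∈nbrs , uy = ∈-filter⁺ High? y∈nbrs
            ([ coloured-neighbour-high high ¬coloured (∈-neighbours⁻ y∈nbrs) , id ]′ uy)

        lowDegree : ∀ {x} → ⊤ → ¬ (Coloured x ⊎ High x) → length (filter (λ _ → yes tt) (neighbours G x)) < 4
        lowDegree {x} _ ¬u = ≤-<-trans (length-filter _ (neighbours G x)) (≰⇒> (¬u ∘ inj₂))

        properExtension : ∃[ c ] (∀ {x y} → x ~ y → c x ≢ c y) ×
          (∀ {x d} → Colour x d → c x ≡ d)
        properExtension
          with greedyExtension Coloured? Coloured∪High? inj₁ fewColoured∪High spiderColouring
                 (λ sx sy → colour-proper (spiderColouring-colour sx) (spiderColouring-colour sy))
        ... | c₁ , proper₁ , agrees₁
          with greedyExtension Coloured∪High? (λ _ → yes tt) (λ _ → tt) lowDegree c₁ proper₁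
        ... | c₂ , proper₂ , agrees₂ = c₂ , proper₂ tt tt , λ colour →
          trans (agrees₂ (inj₁ (_ , colour))) (trans (agrees₁ (_ , colour))
            (colour-unique (spiderColouring-colour (_ , colour)) colour refl))

        spider⇒b*-coloring : HasB*Coloring G 4
        spider⇒b*-coloring with properExtension
        ... | c , proper , extends = c , (surjective , proper) , body , nice
          where
          c-body : c body ≡ zero
          c-body = extends atBody

          c-knee : ∀ i → c (knee i) ≡ suc i
          c-knee = extends ∘ knee-colour

          surjective : ∀ j → ∃[ x ] ∀ {z} → z ≡ x → c z ≡ j
          surjective zero    = body , λ { refl → c-body }
          surjective (suc i) = knee i , λ { refl → c-knee i }

          knee-b-vertex : ∀ i → IsBVertex G c (knee i)
          knee-b-vertex i zero    _     = body , ~-sym (body~knee i) , c-body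
          -- The foot with colour `suc j` is the one whose position `punchIn i` sends to `j`.
          knee-b-vertex i (suc j) 1+j≢c = foot i k , knee~foot i k ,
            trans (extends (atFoot i k)) (cong suc (punchIn-punchOut i≢j))
            where
            i≢j : i ≢ j
            i≢j refl = 1+j≢c (sym (c-knee i))
            k : Fin 2
            k = punchOut i≢j

          nice : IsNice G c body
          nice zero    0≢c = contradiction (sym c-body) 0≢c
          nice (suc i) _   = knee i , body~knee i , c-knee i , knee-b-vertex i

-- Both bounds combined.

proposition2 : (G : Graph) → HasGirth G 6 → IsM* G 3 → IsB* G 4
proposition2 G (_ , girth≥6) (dense , largest) =
  spider⇒b*-coloring G girth≥6 (dense⇒spider G dense) (λ dense₄ → <⇒≱ ≤-refl (largest 4 dense₄)) , upper
  where
  upper : ∀ k → HasB*Coloring G k → k ≤ 4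
  upper zero    _  = z≤n
  upper (suc k) b* = s≤s (largest k (b*-coloring⇒dense G b*))
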